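{- Let $i\ge 0$ and let $K_1,K_2$ be finite simplicial complexes such that $B_i(K_1)$ and $B_i(K_2)$ are connected ($K_1,K_2$ are $(i+1)$-path connected). Then $B_i(K_1\Box K_2)$ is balanced if and only if $B_i(K_1)$ and $B_i(K_2)$ are both balanced.
   Context: The Cartesian product $K_1\Box K_2$ is the complex on $V(K_1)\times V(K_2)$ whose faces are $F\times v=\{(u_0,v),\dots,(u_s,v)\}$ for $F=\{u_0,\dots,u_s\}\in K_1$, $v\in V(K_2)$, and $u\times F'=\{(u,v_0),\dots,(u,v_t)\}$ for $u\in V(K_1)$, $F'=\{v_0,\dots,v_t\}\in K_2$. $S_j(K)$ is the set of faces of cardinality $j+1$. For a complex $K$ with an orientation (ordering of each face up to even permutations), $B_i(K)$ is the signed bipartite graph on $S_i(K)\cup S_{i+1}(K)$ with edges $\{F,\bar F\}$ for $F\subset\bar F$, signed by the boundary incidence sign $\mathrm{sgn}([F],\partial[\bar F])\in\{\pm1\}$ ($(-1)^j$ if $F$ is $\bar F$ minus its $j$-th vertex with agreeing orientation, negated otherwise). A signed graph is balanced if every cycle has positive sign product; this is independent of the orientation. -}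

module Defs where

import Data.Bool as Bool
open import Data.Bool using (true; if_then_else_; _∧_)
open import Data.Fin using (Fin; zero; suc; toℕ; combine; remQuot)
import Data.Fin.Properties as Fin
open import Data.Fin.Properties using (remQuot-combine; combine-remQuot; any?)
open import Data.Fin.Subset using (Subset; _∈_; _⊆_; _⊂_; ⁅_⁆; ∣_∣)
open import Data.Fin.Subset.Properties
  using (_∈?_; anySubset?; ⊆-antisym; x∈⁅x⁆; x∈⁅y⁆⇒x≡y)
open import Data.List as List using (List; []; _∷_)
open import Data.List.Relation.Unary.Unique.Propositional using (Unique)
open import Data.Nat as ℕ using (ℕ; zero; suc; NonZero; _≤_)
open import Data.Nat.Properties using (m*n≢0)
open import Data.Product using (_×_; _,_; proj₁; proj₂)
open import Data.Sign as Sign using (Sign; opposite)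
open import Data.Sum using (_⊎_; inj₁; inj₂)
open import Data.Vec as Vec using (Vec; []; _∷_; lookup; tabulate; removeAt)
import Data.Vec.Membership.Propositional as VecMem
open import Data.Vec.Properties
  using (lookup∘tabulate; []=⇒lookup; lookup⇒[]=; ≡-dec)
import Data.Vec.Relation.Unary.Unique.Propositional as VecUnique
open import Function using (_⇔_)
open import Relation.Binary using (Rel)
open import Relation.Binary.Construct.Closure.ReflexiveTransitive
  using (Star; ε; _◅_)
open import Relation.Binary.PropositionalEquality
  using (_≡_; refl; sym; trans; cong; cong₂; subst)
open import Relation.Nullary using (¬_; does)
open import Relation.Nullary.Decidable using (map′; _×-dec_; _⊎-dec_)
open import Relation.Unary using (Decidable)
open import Level using (0ℓ)

record SignedGraph : Set₁ where
  field
    Vertex     : Set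
    Adj        : Rel Vertex 0ℓ
    adj-sym    : ∀ {x y} → Adj x y → Adj y x
    adj-irrefl : ∀ {x} → ¬ Adj x x
    sign       : ∀ {x y} → Adj x y → Sign
    -- With adj-sym this also makes the sign independent of the
    -- adjacency proof, so it is a function of the undirected edge {x , y}.
    sign-sym   : ∀ {x y} (e : Adj x y) (e′ : Adj y x) → sign e ≡ sign e′

module _ (G : SignedGraph) where
  open SignedGraph G

  Walk : Rel Vertex 0ℓ
  Walk = Star Adj

  Connected : Set
  Connected = ∀ x y → Walk x y

  -- The start point of every step; for a closed walk each visit is
  -- listed once, the final return to the base point being omitted.
  visited : ∀ {x y} → Walk x y → List Vertex
  visited ε               = []
  visited (_◅_ {x} _ w) = x ∷ visited w

  walkSign : ∀ {x y} → Walk x y → Sign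
  walkSign ε       = Sign.+
  walkSign (e ◅ w) = sign e Sign.* walkSign w

  -- The length bound excludes the trivial closed walk and a single edge
  -- traversed back and forth.
  IsCycle : ∀ {x} → Walk x x → Set
  IsCycle w = 3 ≤ List.length (visited w) × Unique (visited w)

  Balanced : Set
  Balanced = ∀ {x} (w : Walk x x) → IsCycle w → walkSign w ≡ Sign.+

-- The vertex set is Fin n, up to relabelling any finite nonempty set.
-- The empty set counts as a face; it belongs to no Face K j below.
record Complex (n : ℕ) : Set₁ where
  field
    IsFace      : Subset n → Set
    isFace?     : Decidable IsFace
    down-closed : ∀ {F G} → IsFace G → F ⊆ G → IsFace F
    vertex      : ∀ v → IsFace ⁅ v ⁆
    nonEmpty    : NonZero n

open Complex

-- S_j(K).  The proofs are irrelevant, so that faces with the same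
-- underlying set are equal.
record Face {n} (K : Complex n) (j : ℕ) : Set where
  constructor face
  field
    set     : Subset n
    .isFace : IsFace K set
    .card   : ∣ set ∣ ≡ suc j

open Face

-- An ordering is a representative of its class up to even permutations;
-- incidenceSign below depends only on the class.
record Orientation {n} (K : Complex n) : Set where
  field
    order        : ∀ {j} → Face K j → Vec (Fin n) (suc j)
    order-unique : ∀ {j} (F : Face K j) → VecUnique.Unique (order F)
    order-∈      : ∀ {j} (F : Face K j) {v} → v VecMem.∈ order F ⇔ v ∈ set F

[-1]^_ : ℕ → Sign
[-1]^ zero  = Sign.+
[-1]^ suc k = opposite ([-1]^ k)

indexOf : ∀ {n k} → Vec (Fin n) k → Fin n → ℕ
indexOf []       y = 0
indexOf (x ∷ xs) y = if does (x Fin.≟ y) then 0 else suc (indexOf xs y)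

inversions : List ℕ → ℕ
inversions []       = 0
inversions (a ∷ as) = List.length (List.filter (ℕ._<? a) as) ℕ.+ inversions as

-- For two orderings of one set, the sign of the permutation carrying xs
-- to ys: + exactly when they define the same orientation.
permSign : ∀ {n k} → Vec (Fin n) k → Vec (Fin n) k → Sign
permSign xs ys = [-1]^ inversions (List.map (indexOf xs) (Vec.toList ys))

-- The position of the first entry outside F.  The last clause does not
-- test its entry; when F omits exactly one entry it can only be that one.
missing : ∀ {n k} → Subset n → Vec (Fin n) (suc k) → Fin (suc k)
missing F (x ∷ xs@(_ ∷ _)) = if does (x ∈? F) then suc (missing F xs) else zero
missing F (x ∷ [])         = zero

-- sgn([F], ∂[F̄]), for F ⊂ F̄.
incidenceSign : ∀ {n} {K : Complex n} → Orientation K →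
                ∀ {j} → Face K j → Face K (suc j) → Sign
incidenceSign o F F̄ = ([-1]^ toℕ j) Sign.* permSign (removeAt (order F̄) j) (order F)
  where
  open Orientation o
  j = missing (set F) (order F̄)

module _ {n} (K : Complex n) (o : Orientation K) (i : ℕ) where

  data Incident : Rel (Face K i ⊎ Face K (suc i)) 0ℓ where
    up   : ∀ {F F̄} → set F ⊂ set F̄ → Incident (inj₁ F) (inj₂ F̄)
    down : ∀ {F F̄} → set F ⊂ set F̄ → Incident (inj₂ F̄) (inj₁ F)

  B : SignedGraph
  B = record
    { Vertex     = Face K i ⊎ Face K (suc i)
    ; Adj        = Incident
    ; adj-sym    = λ { (up p) → down p ; (down p) → up p }
    ; adj-irrefl = λ ()
    ; sign       = sgn
    ; sign-sym   = λ { (up _) (down _) → refl ; (down _) (up _) → refl }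
    }
    where
    sgn : ∀ {x y} → Incident x y → Sign
    sgn (up   {F} {F̄} _) = incidenceSign o F F̄
    sgn (down {F} {F̄} _) = incidenceSign o F F̄

-- The product of two subsets, with Fin m × Fin n identified with
-- Fin (m * n) by combine and remQuot.
infixr 7 _⊗_
_⊗_ : ∀ {m n} → Subset m → Subset n → Subset (m ℕ.* n)
_⊗_ {m} {n} F G = tabulate λ w →
  lookup F (proj₁ (remQuot {m} n w)) ∧ lookup G (proj₂ (remQuot {m} n w))

module _ {m n} {F : Subset m} {G : Subset n} where

  lookup-⊗ : ∀ u v → lookup (F ⊗ G) (combine u v) ≡ lookup F u ∧ lookup G v
  lookup-⊗ u v = trans
    (lookup∘tabulate _ (combine u v))
    (cong (λ p → lookup F (proj₁ p) ∧ lookup G (proj₂ p)) (remQuot-combine u v))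

  ∈-⊗⁺ : ∀ {u v} → u ∈ F → v ∈ G → combine u v ∈ F ⊗ G
  ∈-⊗⁺ {u} {v} p q = lookup⇒[]= _ _
    (trans (lookup-⊗ u v) (cong₂ _∧_ ([]=⇒lookup p) ([]=⇒lookup q)))

  ∈-⊗⁻ : ∀ {u v} → combine u v ∈ F ⊗ G → u ∈ F × v ∈ G
  ∈-⊗⁻ {u} {v} p
    with lookup F u in eF | lookup G v in eG | trans (sym (lookup-⊗ u v)) ([]=⇒lookup p)
  ... | true | true | _ = lookup⇒[]= u F eF , lookup⇒[]= v G eG

⊆-combine : ∀ {m n} {P Q : Subset (m ℕ.* n)} →
            (∀ u v → combine {m} {n} u v ∈ P → combine u v ∈ Q) → P ⊆ Q
⊆-combine {m} {n} {P} {Q} h {w} w∈P =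
  subst (_∈ Q) eq (h _ _ (subst (_∈ P) (sym eq) w∈P))
  where eq = combine-remQuot {m} n w

module _ {m n} (K₁ : Complex m) (K₂ : Complex n) where

  data ProductFace : Subset (m ℕ.* n) → Set where
    horizontal : ∀ {F} → IsFace K₁ F → (v : Fin n) → ProductFace (F ⊗ ⁅ v ⁆)
    vertical   : ∀ (u : Fin m) {F′} → IsFace K₂ F′ → ProductFace (⁅ u ⁆ ⊗ F′)

  private
    productFace? : Decidable ProductFace
    productFace? P = map′
      (λ { (inj₁ (F , f , v , refl)) → horizontal f v
         ; (inj₂ (F , f , u , refl)) → vertical u f })
      (λ { (horizontal f v) → inj₁ (_ , f , v , refl)
         ; (vertical u f)   → inj₂ (_ , f , u , refl) })
      (anySubset? (λ F → isFace? K₁ F ×-dec any? λ (v : Fin n) → ≡-dec Bool._≟_ P (F ⊗ ⁅ v ⁆))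
        ⊎-dec
       anySubset? (λ F → isFace? K₂ F ×-dec any? λ (u : Fin m) → ≡-dec Bool._≟_ P (⁅ u ⁆ ⊗ F)))

    productDown : ∀ {P Q} → ProductFace Q → P ⊆ Q → ProductFace P
    productDown {P} (horizontal {F} f v) P⊆Q =
      subst ProductFace (⊆-antisym (⊆-combine {m} {n} to) (⊆-combine {m} {n} from))
        (horizontal (down-closed K₁ f F′⊆F) v)
      where
      F′ : Subset m
      F′ = tabulate λ u → lookup P (combine u v)
      F′⁻ : ∀ {u} → u ∈ F′ → combine u v ∈ P
      F′⁻ {u} p = lookup⇒[]= _ _ (trans (sym (lookup∘tabulate _ u)) ([]=⇒lookup p))
      F′⁺ : ∀ {u} → combine u v ∈ P → u ∈ F′
      F′⁺ {u} p = lookup⇒[]= _ _ (trans (lookup∘tabulate _ u) ([]=⇒lookup p))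
      F′⊆F : F′ ⊆ F
      F′⊆F p = proj₁ (∈-⊗⁻ {F = F} {⁅ v ⁆} (P⊆Q (F′⁻ p)))
      to : ∀ (u : Fin m) (v′ : Fin n) → combine u v′ ∈ F′ ⊗ ⁅ v ⁆ → combine u v′ ∈ P
      to u v′ p with a , b ← ∈-⊗⁻ {F = F′} {⁅ v ⁆} {u} {v′} p
        with refl ← x∈⁅y⁆⇒x≡y v b = F′⁻ a
      from : ∀ (u : Fin m) (v′ : Fin n) → combine u v′ ∈ P → combine u v′ ∈ F′ ⊗ ⁅ v ⁆
      from u v′ p with refl ← x∈⁅y⁆⇒x≡y v (proj₂ (∈-⊗⁻ {F = F} {⁅ v ⁆} {u} {v′} (P⊆Q p))) =
        ∈-⊗⁺ {F = F′} {⁅ v ⁆} (F′⁺ p) (x∈⁅x⁆ v)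
    productDown {P} (vertical u {F} f) P⊆Q =
      subst ProductFace (⊆-antisym (⊆-combine {m} {n} to) (⊆-combine {m} {n} from))
        (vertical u (down-closed K₂ f F′⊆F))
      where
      F′ : Subset n
      F′ = tabulate λ v → lookup P (combine u v)
      F′⁻ : ∀ {v} → v ∈ F′ → combine u v ∈ P
      F′⁻ {v} p = lookup⇒[]= _ _ (trans (sym (lookup∘tabulate _ v)) ([]=⇒lookup p))
      F′⁺ : ∀ {v} → combine u v ∈ P → v ∈ F′
      F′⁺ {v} p = lookup⇒[]= _ _ (trans (lookup∘tabulate _ v) ([]=⇒lookup p))
      F′⊆F : F′ ⊆ F
      F′⊆F p = proj₂ (∈-⊗⁻ {F = ⁅ u ⁆} {F} {u} (P⊆Q (F′⁻ p)))
      to : ∀ (u′ : Fin m) (v : Fin n) → combine u′ v ∈ ⁅ u ⁆ ⊗ F′ → combine u′ v ∈ P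
      to u′ v p with a , b ← ∈-⊗⁻ {F = ⁅ u ⁆} {F′} {u′} {v} p
        with refl ← x∈⁅y⁆⇒x≡y u a = F′⁻ b
      from : ∀ (u′ : Fin m) (v : Fin n) → combine u′ v ∈ P → combine u′ v ∈ ⁅ u ⁆ ⊗ F′
      from u′ v p with refl ← x∈⁅y⁆⇒x≡y u (proj₁ (∈-⊗⁻ {F = ⁅ u ⁆} {F} {u′} {v} (P⊆Q p))) =
        ∈-⊗⁺ {F = ⁅ u ⁆} {F′} (x∈⁅x⁆ u) (F′⁺ p)

    productVertex : ∀ w → ProductFace ⁅ w ⁆
    productVertex w = productDown (horizontal (vertex K₁ u) v) λ {x} x∈ →
      subst (_∈ ⁅ u ⁆ ⊗ ⁅ v ⁆)
        (trans (combine-remQuot {m} n w) (sym (x∈⁅y⁆⇒x≡y w x∈)))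
        (∈-⊗⁺ {F = ⁅ u ⁆} {⁅ v ⁆} (x∈⁅x⁆ u) (x∈⁅x⁆ v))
      where
      u = proj₁ (remQuot {m} n w)
      v = proj₂ (remQuot {m} n w)

  infixr 6 _□_
  _□_ : Complex (m ℕ.* n)
  _□_ = record
    { IsFace      = ProductFace
    ; isFace?     = productFace?
    ; down-closed = productDown
    ; vertex      = productVertex
    ; nonEmpty    = m*n≢0 m n {{nonEmpty K₁}} {{nonEmpty K₂}}
    }

{-# OPTIONS --safe #-}

-- Let switch F be the sign of the chosen ordering of a face F relative to the natural order
-- of the vertices.  Then
--   incidenceSign o F F̄ ≡ switch F * switch F̄ * (-1) ^ #{z ∈ F̄ : z < u},
-- where u is the vertex in F̄ ∖ F, and the last factor is preserved by monotone embeddings of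
-- the vertex set.  Both embeddings u ↦ (u , v) and v ↦ (u , v) are monotone, so up to
-- switching the signature of B (K₁ □ K₂) restricts on every slice to that of a factor, and
-- cycles of the factors become cycles of the same sign in the product.
--
-- Conversely, a connected balanced signed graph has a potential.  Extend the potentials of the
-- factors to functions c₁, c₂ of arbitrary vertex sets, with value + outside S_i ∪ S_{i+1}.
-- Then P ↦ switch P * c₁ (π₁ P) * c₂ (π₂ P) is a potential of the product: along an incidence
-- inside a slice one of the projections is constant and its contribution cancels.  For i ≥ 1
-- the constant projection contributes +, for i = 0 it is the potential of a vertex.
module Submission where

open import Defs
import Data.Bool as Bool
open import Data.Bool using (true; false; if_then_else_)
open import Data.Empty using (⊥-elim-irr)
open import Data.Fin as Fin using (Fin; zero; suc; toℕ; combine)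
import Data.Fin.Properties as Fin
open import Data.Fin.Properties using (any?; combine-surjective; combine-monoˡ-<; toℕ-combine)
open import Data.Fin.Subset using (Subset; inside; outside; _⊆_; _⊂_; ⁅_⁆; ∣_∣)
  renaming (_∈_ to _∈ₛ_; _∉_ to _∉ₛ_)
open import Data.Fin.Subset.Properties
  using (_∈?_; anySubset?; ⊆-antisym; ⊆-refl; x∈⁅x⁆; x∈⁅y⁆⇒x≡y)
open import Data.List as List using (List; []; _∷_; _++_; length)
open import Data.List.Membership.Propositional using (_∈_; _∉_)
import Data.List.Membership.DecPropositional as DecMembership
open import Data.List.Membership.Propositional.Properties using (∈-∃++; ∈-map⁺; ∈-map⁻)
open import Data.List.Membership.Propositional.Properties.WithK using (unique∧set⇒bag)
open import Data.List.Properties using (length-++; length-map)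
open import Data.List.Relation.Binary.BagAndSetEquality using (∼bag⇒↭)
open import Data.List.Relation.Binary.Permutation.Propositional as ↭
  using (_↭_; refl; prep; swap; ↭-sym; ↭-trans; ↭⇒↭ₛ)
open import Data.List.Relation.Binary.Permutation.Propositional.Properties
  using (∈-resp-↭; shift; ++-identityʳ; ↭-length; drop-∷)
import Data.List.Relation.Binary.Permutation.Setoid.Properties as ↭ₛ
open import Data.List.Relation.Unary.All as All using ([]; _∷_)
open import Data.List.Relation.Unary.All.Properties using (¬Any⇒All¬)
open import Data.List.Relation.Unary.AllPairs using ([]; _∷_)
open import Data.List.Relation.Unary.Any as Any using (here; there)
open import Data.List.Relation.Unary.Unique.Propositional using (Unique)
import Data.List.Relation.Unary.Unique.Propositional.Properties as Unique
open import Data.Nat as ℕ using (ℕ; zero; suc; NonZero; _≤_; z≤n; s≤s)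
import Data.Nat.Properties as ℕ
open import Data.Product using (∃; _×_; _,_; proj₁; proj₂)
open import Data.Sign using (Sign; opposite; _*_; +; -)
open import Data.Sign.Properties
  using (_≟_; *-assoc; *-comm; *-identityʳ; s*s≡+; *-commutativeSemigroup)
open import Algebra.Properties.CommutativeSemigroup *-commutativeSemigroup
  using (interchange; x∙yz≈y∙xz)
open import Data.Sum using (inj₁; inj₂)
import Data.Sum.Properties as Sum
open import Data.Vec using (Vec; []; _∷_; lookup; removeAt; toList; tabulate; here; there)
open import Data.Vec.Membership.Propositional.Properties using (∈-toList⁺; ∈-toList⁻; ∈-lookup)
open import Data.Vec.Properties
  using (≡-dec; length-toList; lookup∘tabulate; []=⇒lookup; lookup⇒[]=)
open import Data.Vec.Relation.Unary.All.Properties using (toList⁺)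
open import Data.Vec.Relation.Unary.AllPairs using ([]; _∷_)
import Data.Vec.Relation.Unary.Unique.Propositional as VecUnique
open import Function using (_∘_; _⇔_; mk⇔; module Equivalence)
open import Function.Construct.Composition using (_⇔-∘_)
open import Function.Construct.Symmetry using (⇔-sym)
open import Relation.Binary.Construct.Closure.ReflexiveTransitive using (ε; _◅_; _◅◅_; gmap)
open import Relation.Binary.Definitions using (DecidableEquality; tri<; tri≈; tri>)
open import Relation.Binary.PropositionalEquality
open import Relation.Nullary using (¬_; Dec; yes; no; does; contradiction)
open import Relation.Nullary.Decidable
  using (map′; from-yes; recompute; dec-true; dec-false; _×-dec_; _⊎-dec_)
open import Relation.Unary using (Decidable)

open Complex
open Face
open Orientation
open Equivalence using (to; from)

private variable
  A C   : Set
  m n k : ℕ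

-- A sign takes two values, so an identity in finitely many sign variables is decidable and
-- `from-yes` proves it by evaluation.
∀-sign? : {P : Sign → Set} → Decidable P → Dec (∀ s → P s)
∀-sign? P? = map′ (λ { (p , q) + → p ; (p , q) - → q }) (λ f → f + , f -)
                  (P? + ×-dec P? -)

[-1]^-+ : ∀ a b → [-1]^ (a ℕ.+ b) ≡ ([-1]^ a) * ([-1]^ b)
[-1]^-+ zero    b = refl
[-1]^-+ (suc a) b rewrite [-1]^-+ a b with [-1]^ a
... | + = refl
... | - = from-yes (∀-sign? λ s → opposite (opposite s) ≟ s) ([-1]^ b)

-- Products of signs over a list and over the pairs of its entries

∏ : (A → Sign) → List A → Sign
∏ f []       = +
∏ f (x ∷ xs) = f x * ∏ f xs

∏₂ : (A → A → Sign) → List A → Sign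
∏₂ g []       = +
∏₂ g (x ∷ xs) = ∏ (g x) xs * ∏₂ g xs

∏-cong : ∀ {f g : A → Sign} xs → (∀ {x} → x ∈ xs → f x ≡ g x) → ∏ f xs ≡ ∏ g xs
∏-cong []       eq = refl
∏-cong (x ∷ xs) eq = cong₂ _*_ (eq (here refl)) (∏-cong xs (eq ∘ there))

∏₂-cong : ∀ {f g : A → A → Sign} xs →
          (∀ {x y} → x ∈ xs → y ∈ xs → f x y ≡ g x y) → ∏₂ f xs ≡ ∏₂ g xs
∏₂-cong []       eq = refl
∏₂-cong (x ∷ xs) eq = cong₂ _*_
  (∏-cong xs (eq (here refl) ∘ there))
  (∏₂-cong xs λ p q → eq (there p) (there q))

∏-* : ∀ (f g : A → Sign) xs → ∏ (λ x → f x * g x) xs ≡ ∏ f xs * ∏ g xs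
∏-* f g []       = refl
∏-* f g (x ∷ xs) rewrite ∏-* f g xs = interchange (f x) (g x) (∏ f xs) (∏ g xs)

∏₂-* : ∀ (f g : A → A → Sign) xs → ∏₂ (λ x y → f x y * g x y) xs ≡ ∏₂ f xs * ∏₂ g xs
∏₂-* f g []       = refl
∏₂-* f g (x ∷ xs) rewrite ∏-* (f x) (g x) xs | ∏₂-* f g xs =
  interchange (∏ (f x) xs) (∏ (g x) xs) (∏₂ f xs) (∏₂ g xs)

∏-map : ∀ (f : C → Sign) (h : A → C) xs → ∏ f (List.map h xs) ≡ ∏ (f ∘ h) xs
∏-map f h []       = refl
∏-map f h (x ∷ xs) = cong (f (h x) *_) (∏-map f h xs)

∏-↭ : ∀ (f : A → Sign) {xs ys} → xs ↭ ys → ∏ f xs ≡ ∏ f ys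
∏-↭ f refl              = refl
∏-↭ f (prep x p)        = cong (f x *_) (∏-↭ f p)
∏-↭ f (swap {xs} x y p) = trans (x∙yz≈y∙xz (f x) (f y) (∏ f xs))
                                (cong (λ s → f y * (f x * s)) (∏-↭ f p))
∏-↭ f (↭.trans p q)     = trans (∏-↭ f p) (∏-↭ f q)

-- Transposing neighbours affects only the factor of that pair. Symmetry is asked on members only,
-- because `indexOf` is injective only there.
∏₂-↭ : ∀ (g : A → A → Sign) {xs ys} → xs ↭ ys →
       (∀ {x y} → x ∈ xs → y ∈ xs → g x y ≡ g y x) → ∏₂ g xs ≡ ∏₂ g ys
∏₂-↭ g refl       sm = refl
∏₂-↭ g (prep x p) sm =
  cong₂ _*_ (∏-↭ (g x) p) (∏₂-↭ g p λ a b → sm (there a) (there b))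
∏₂-↭ g (swap {xs} {ys} x y p) sm
  rewrite sm (here refl) (there (here refl))
        | ∏₂-↭ g p (λ a b → sm (there (there a)) (there (there b)))
        | ∏-↭ (g x) p | ∏-↭ (g y) p =
  interchange (g y x) (∏ (g x) ys) (∏ (g y) ys) (∏₂ g ys)
∏₂-↭ g (↭.trans p q) sm = trans (∏₂-↭ g p sm)
  (∏₂-↭ g q λ a b → sm (∈-resp-↭ (↭-sym p) a) (∈-resp-↭ (↭-sym p) b))

-- Permutations of lists without repetition

unique-⊆⇒↭-++ : ∀ {xs ys : List A} → Unique xs → (∀ {x} → x ∈ xs → x ∈ ys) →
                ∃ λ zs → ys ↭ xs ++ zs
unique-⊆⇒↭-++ {xs = []}     {ys} _        _   = ys , refl
unique-⊆⇒↭-++ {xs = x ∷ xs} (x∉ ∷ u) sub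
  with as , bs , refl ← ∈-∃++ (sub (here refl))
  with zs , p ← unique-⊆⇒↭-++ u (λ {y} y∈ →
         Any.tail (λ { refl → All.lookup x∉ y∈ refl }) (∈-resp-↭ (shift x as bs) (sub (there y∈))))
  = zs , ↭-trans (shift x as bs) (prep x p)

-- Comparing lengths, the remainder `zs` of `unique-⊆⇒↭-++` must be empty.
unique-⊆⇒↭ : ∀ {xs ys : List A} → Unique xs → (∀ {x} → x ∈ xs → x ∈ ys) →
             length ys ≡ length xs → ys ↭ xs
unique-⊆⇒↭ {xs = xs} u sub eq with unique-⊆⇒↭-++ u sub
... | []     , p = ↭-trans p (++-identityʳ xs)
... | z ∷ zs , p = contradiction
  (trans (sym eq) (trans (↭-length p) (↭-length (shift z xs zs))))
  (ℕ.<⇒≢ (ℕ.s≤s (subst (length xs ≤_) (sym (length-++ xs)) (ℕ.m≤m+n _ _))))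

-- Inversions and the sign of an ordering

invSign : ℕ → ℕ → Sign
invSign a b = if does (b ℕ.<? a) then - else +

invSign-< : ∀ {a b} → b ℕ.< a → invSign a b ≡ -
invSign-< {a} {b} p = cong (if_then - else +) (dec-true (b ℕ.<? a) p)

invSign-≮ : ∀ {a b} → ¬ b ℕ.< a → invSign a b ≡ +
invSign-≮ {a} {b} ¬p = cong (if_then - else +) (dec-false (b ℕ.<? a) ¬p)

invSign-antisym : ∀ {a b} → a ≢ b → invSign a b ≡ opposite (invSign b a)
invSign-antisym {a} {b} a≢b with ℕ.<-cmp a b
... | tri< p _ ¬q = trans (invSign-≮ ¬q) (cong opposite (sym (invSign-< p)))
... | tri≈ _ eq _ = contradiction eq a≢b
... | tri> ¬p _ q = trans (invSign-< q) (cong opposite (sym (invSign-≮ ¬p)))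

inversions-sign : ∀ (f : A → ℕ) xs →
                  [-1]^ inversions (List.map f xs) ≡ ∏₂ (λ x y → invSign (f x) (f y)) xs
inversions-sign f []       = refl
inversions-sign f (x ∷ xs) = trans
  ([-1]^-+ (length (List.filter (ℕ._<? f x) (List.map f xs))) _)
  (cong₂ _*_ (row (f x) xs) (inversions-sign f xs))
  where
  row : ∀ a xs → [-1]^ length (List.filter (ℕ._<? a) (List.map f xs)) ≡ ∏ (λ y → invSign a (f y)) xs
  row a []       = refl
  row a (y ∷ xs) with f y ℕ.<ᵇ a | row a xs
  ... | true  | ih = cong opposite ih
  ... | false | ih = ih

-- For a list without repetition this is the sign of the permutation that sorts it.
σ : List (Fin n) → Sign
σ = ∏₂ λ x y → invSign (toℕ x) (toℕ y)

indexOf-head : ∀ (x : Fin n) (xs : Vec (Fin n) k) → indexOf (x ∷ xs) x ≡ 0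
indexOf-head x xs with x Fin.≟ x
... | yes _  = refl
... | no x≢x = contradiction refl x≢x

indexOf-tail : ∀ {x y : Fin n} (xs : Vec (Fin n) k) → x ≢ y →
               indexOf (x ∷ xs) y ≡ suc (indexOf xs y)
indexOf-tail {x = x} {y} xs x≢y with x Fin.≟ y
... | yes eq = contradiction eq x≢y
... | no _   = refl

indexOf-injective : ∀ (xs : Vec (Fin n) k) {x y} → x ∈ toList xs →
                    indexOf xs x ≡ indexOf xs y → x ≡ y
indexOf-injective (z ∷ zs) {x} {y} x∈ eq with z Fin.≟ x | z Fin.≟ y
... | yes refl | yes refl = refl
... | no z≢x   | no _     = indexOf-injective zs (Any.tail (z≢x ∘ sym) x∈) (ℕ.suc-injective eq)

-- The head has index 0, so no later entry is inverted with it. The other indices all shift by one,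
-- which leaves their comparisons unchanged.
∏₂-indexOf : ∀ (xs : Vec (Fin n) k) → Unique (toList xs) →
             ∏₂ (λ x y → invSign (indexOf xs x) (indexOf xs y)) (toList xs) ≡ +
∏₂-indexOf []       _        = refl
∏₂-indexOf (x ∷ xs) (x∉ ∷ u) = cong₂ _*_
  (trans (∏-cong (toList xs) λ {y} _ →
            cong (λ a → invSign a (indexOf (x ∷ xs) y)) (indexOf-head x xs))
         (∏-+ (toList xs)))
  (trans (∏₂-cong (toList xs) λ p q → cong₂ invSign (indexOf-tail xs (All.lookup x∉ p))
                                                (indexOf-tail xs (All.lookup x∉ q)))
         (∏₂-indexOf xs u))
  where
  ∏-+ : ∀ ys → ∏ (λ (_ : A) → +) ys ≡ +
  ∏-+ []       = refl
  ∏-+ (_ ∷ ys) = ∏-+ ys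

-- The inversions of ys with respect to the order of xs, compared with those with
-- respect to the natural order, are counted by a symmetric function of pairs,
-- whose product may hence be taken over xs instead of ys.
permSign-σ : ∀ (xs ys : Vec (Fin n) k) → Unique (toList xs) →
             toList xs ↭ toList ys → permSign xs ys ≡ σ (toList xs) * σ (toList ys)
permSign-σ {n} xs ys u p = begin
  permSign xs ys                        ≡⟨ inversions-sign (indexOf xs) (toList ys) ⟩
  ∏₂ i (toList ys)                      ≡⟨ cancel (∏₂ i (toList ys)) (σ (toList ys)) ⟨
  ∏₂ i (toList ys) * σ (toList ys) * σ (toList ys)
    ≡⟨ cong (_* σ (toList ys)) (∏₂-* i t (toList ys)) ⟨
  ∏₂ g (toList ys) * σ (toList ys)      ≡⟨ cong (_* σ (toList ys)) (∏₂-↭ g p g-sym) ⟨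
  ∏₂ g (toList xs) * σ (toList ys)      ≡⟨ cong (_* σ (toList ys)) (∏₂-* i t (toList xs)) ⟩
  ∏₂ i (toList xs) * σ (toList xs) * σ (toList ys)
    ≡⟨ cong (λ s → s * σ (toList xs) * σ (toList ys)) (∏₂-indexOf xs u) ⟩
  σ (toList xs) * σ (toList ys)         ∎
  where
  open ≡-Reasoning
  i t g : Fin n → Fin n → Sign
  i x y = invSign (indexOf xs x) (indexOf xs y)
  t x y = invSign (toℕ x) (toℕ y)
  g x y = i x y * t x y
  cancel : ∀ a b → a * b * b ≡ a
  cancel = from-yes (∀-sign? λ a → ∀-sign? λ b → a * b * b ≟ a)
  opp² : ∀ a b → opposite a * opposite b ≡ a * b
  opp² = from-yes (∀-sign? λ a → ∀-sign? λ b → opposite a * opposite b ≟ a * b)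
  g-sym : ∀ {x y} → x ∈ toList xs → y ∈ toList xs → g x y ≡ g y x
  g-sym {x} {y} x∈ y∈ with x Fin.≟ y
  ... | yes refl = refl
  ... | no  x≢y  = trans
    (cong₂ _*_ (invSign-antisym (x≢y ∘ indexOf-injective xs x∈))
               (invSign-antisym (x≢y ∘ Fin.toℕ-injective)))
    (opp² (i y x) (t y x))

-- The sign `(-1) ^ #{z < u}`: for a naturally ordered list containing `u`, the boundary sign of
-- deleting `u`.
below : Fin n → List (Fin n) → Sign
below u = ∏ λ z → invSign (toℕ u) (toℕ z)

below-self : ∀ (u : Fin n) → invSign (toℕ u) (toℕ u) ≡ +
below-self u = invSign-≮ {toℕ u} (ℕ.<-irrefl refl)

toList-removeAt : ∀ (xs : Vec A (suc k)) j → toList xs ↭ lookup xs j ∷ toList (removeAt xs j)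
toList-removeAt (x ∷ xs)         zero    = refl
toList-removeAt (x ∷ xs@(_ ∷ _)) (suc j) =
  ↭-trans (prep x (toList-removeAt xs j)) (swap x (lookup xs j) refl)

-- Moving entry `j` to the front takes `j` transpositions, each flipping `σ`. Once in front, the
-- pairs it forms contribute exactly `below`.
σ-removeAt : ∀ (xs : Vec (Fin n) (suc k)) → Unique (toList xs) → ∀ j →
             ([-1]^ toℕ j) * σ (toList (removeAt xs j)) ≡
             σ (toList xs) * below (lookup xs j) (toList xs)
σ-removeAt (x ∷ xs) _ zero rewrite below-self x =
  swap′ (σ (toList xs)) (below x (toList xs))
  where
  swap′ : ∀ a b → a ≡ b * a * b
  swap′ = from-yes (∀-sign? λ a → ∀-sign? λ b → a ≟ b * a * b)
σ-removeAt (x ∷ xs@(_ ∷ _)) (x∉ ∷ uniq) (suc j)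
  rewrite ∏-↭ (λ z → invSign (toℕ x) (toℕ z)) (toList-removeAt xs j)
        -- The pair of `x` and the removed entry is compared in one direction by `σ` and in the
        -- other by `below`. The two factors are opposite, which accounts for the extra sign of
        -- `suc j`.
        | invSign-antisym {toℕ (lookup xs j)} {toℕ x}
            (All.lookup x∉ (∈-resp-↭ (↭-sym (toList-removeAt xs j)) (here refl))
              ∘ sym ∘ Fin.toℕ-injective)
  = algebra ([-1]^ toℕ j) (below x (toList (removeAt xs j))) (σ (toList (removeAt xs j)))
            (invSign (toℕ x) (toℕ (lookup xs j))) (σ (toList xs)) (below (lookup xs j) (toList xs))
            (σ-removeAt xs uniq j)
  where
  algebra : ∀ a b c d e f → a * c ≡ e * f → opposite a * (b * c) ≡ (d * b) * e * (opposite d * f)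
  algebra a b c d e f eq = trans (l a b c) (trans (cong (λ s → opposite b * s) eq) (r b d e f))
    where
    l : ∀ a b c → opposite a * (b * c) ≡ opposite b * (a * c)
    l = from-yes (∀-sign? λ a → ∀-sign? λ b → ∀-sign? λ c →
          opposite a * (b * c) ≟ opposite b * (a * c))
    r : ∀ b d e f → opposite b * (e * f) ≡ (d * b) * e * (opposite d * f)
    r = from-yes (∀-sign? λ b → ∀-sign? λ d → ∀-sign? λ e → ∀-sign? λ f →
          opposite b * (e * f) ≟ (d * b) * e * (opposite d * f))

-- Balance and potentials

-- Equivalently, switching by `φ` makes every edge positive.
IsPotential : (G : SignedGraph) → (SignedGraph.Vertex G → Sign) → Set
IsPotential G φ = ∀ {x y} (e : Adj x y) → sign e ≡ φ x * φ y
  where open SignedGraph G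

module _ (G : SignedGraph) where
  open SignedGraph G

  walkSign-◅◅ : ∀ {x y z} (v : Walk G x y) (w : Walk G y z) →
                walkSign G (v ◅◅ w) ≡ walkSign G v * walkSign G w
  walkSign-◅◅ ε       w = refl
  walkSign-◅◅ (e ◅ v) w = trans (cong (sign e *_) (walkSign-◅◅ v w))
                                (sym (*-assoc (sign e) (walkSign G v) (walkSign G w)))

  -- Along a walk the potential of every intermediate visit occurs twice and cancels. A closed walk
  -- leaves the square of the value at its base point.
  potential⇒balanced : ∀ {φ} → IsPotential G φ → Balanced G
  potential⇒balanced {φ} pot {x} w _ = trans (telescope w) (s*s≡+ (φ x))
    where
    telescope : ∀ {x y} (w : Walk G x y) → walkSign G w ≡ φ x * φ y
    telescope {x}     ε = sym (s*s≡+ (φ x))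
    telescope {x} {z} (_◅_ {j = y} e w) rewrite pot e | telescope w = cancel (φ x) (φ y) (φ z)
      where
      cancel : ∀ a b c → a * b * (b * c) ≡ a * c
      cancel = from-yes (∀-sign? λ a → ∀-sign? λ b → ∀-sign? λ c → a * b * (b * c) ≟ a * c)

  -- In contrast to `visited` the endpoint is listed, so `Unique (trail w)` says that `w` is a path.
  trail : ∀ {x y} → Walk G x y → List Vertex
  trail {x} ε           = x ∷ []
  trail {x} (_ ◅ w)     = x ∷ trail w

  end∈trail : ∀ {x y} (w : Walk G x y) → y ∈ trail w
  end∈trail ε       = here refl
  end∈trail (_ ◅ w) = there (end∈trail w)

  -- An edge from `x` to `y` followed by `before` is a closed walk that visits
  -- `x ∷ visited G before`. Thus `unique` is the simplicity that `IsCycle` demands of it.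
  record Split {y z} (w : Walk G y z) (x : Vertex) : Set where
    field
      before  : Walk G y x
      after   : Walk G x z
      path    : Unique (trail after)
      unique  : Unique (x ∷ visited G before)
      visit⊆  : ∀ {v} → v ∈ visited G before → v ∈ trail w
      sign-≡  : walkSign G w ≡ walkSign G before * walkSign G after

  split : ∀ {x y z} (w : Walk G y z) → Unique (trail w) → x ∈ trail w → Split w x
  split ε u (here refl) = record
    { before = ε ; after = ε ; path = u ; unique = [] ∷ [] ; visit⊆ = λ () ; sign-≡ = refl }
  split (e ◅ w) u (here refl) = record
    { before = ε ; after = e ◅ w ; path = u ; unique = [] ∷ [] ; visit⊆ = λ () ; sign-≡ = refl }
  split {x} {y} (e ◅ w) (y∉ ∷ u) (there x∈) with split w u x∈
  ... | record { before = p ; after = q ; path = qu ; unique = x∉ ∷ pu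
             ; visit⊆ = sub ; sign-≡ = eq } = record
    { before = e ◅ p
    ; after  = q
    ; path   = qu
    ; unique = ((All.lookup y∉ x∈ ∘ sym) ∷ x∉) ∷ All.tabulate (All.lookup y∉ ∘ sub) ∷ pu
    ; visit⊆ = λ { (here eq) → here eq ; (there v∈) → there (sub v∈) }
    ; sign-≡ = trans (cong (sign e *_) eq) (sym (*-assoc (sign e) (walkSign G p) (walkSign G q)))
    }

  module _ (_≟ᵛ_ : DecidableEquality Vertex) (bal : Balanced G) where
    open DecMembership _≟ᵛ_ using () renaming (_∈?_ to _∈ˡ?_)

    -- By the length of `w`: at 0 the edge `e` would be a loop, at 1 the same edge is traversed
    -- twice, and from 2 on the closed walk is a cycle.
    closing-edge : ∀ {x y} (e : Adj x y) (w : Walk G y x) → Unique (x ∷ visited G w) →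
                   sign e * walkSign G w ≡ +
    closing-edge e ε              _ = contradiction e adj-irrefl
    closing-edge e (e′ ◅ ε)       _ rewrite sign-sym e e′ | *-identityʳ (sign e′) = s*s≡+ (sign e′)
    closing-edge e w@(_ ◅ _ ◅ _)  u = bal (e ◅ w) (s≤s (s≤s (s≤s z≤n)) , u)

    -- If e returns to a vertex of the erased path, the loop to remove is a cycle or an edge
    -- traversed back and forth; both are positive.
    loop-erasure : ∀ {x y} (w : Walk G x y) →
                   ∃ λ (p : Walk G x y) → Unique (trail p) × walkSign G p ≡ walkSign G w
    loop-erasure ε = ε , [] ∷ [] , refl
    loop-erasure {x} (e ◅ w) with loop-erasure w
    ... | p , u , eq with x ∈ˡ? trail p
    ...   | no  x∉ = e ◅ p , ¬Any⇒All¬ _ x∉ ∷ u , cong (sign e *_) eq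
    ...   | yes x∈ = after , path , sym (begin
      sign e * walkSign G w                            ≡⟨ cong (sign e *_) (trans (sym eq) sign-≡) ⟩
      sign e * (walkSign G before * walkSign G after)  ≡⟨ *-assoc (sign e) _ _ ⟨
      sign e * walkSign G before * walkSign G after
        ≡⟨ cong (_* walkSign G after) (closing-edge e before unique) ⟩
      walkSign G after                                 ∎)
      where open Split (split p u x∈)
            open ≡-Reasoning

    -- Loop erasure preserves the sign, and the only path from `x` to itself is the trivial one.
    closed-walk-positive : ∀ {x} (w : Walk G x x) → walkSign G w ≡ +
    closed-walk-positive w with loop-erasure w
    ... | ε     , _      , eq = sym eq
    ... | e ◅ p , x∉ ∷ _ , _  = contradiction refl (All.lookup x∉ (end∈trail p))

    -- The potential at `x` is the sign of the chosen walk from a base point `b` to `x`. The closed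
    -- walks `b`-`x`-`y`-`b` and `b`-`y`-`b` are positive and share the return walk, which
    -- determines the sign of the edge.
    balanced⇒potential : Connected G → Dec Vertex → ∃ (IsPotential G)
    balanced⇒potential _    (no empty) = (λ _ → +) , λ {x} _ → contradiction x empty
    balanced⇒potential conn (yes b)    = (λ x → walkSign G (conn b x)) , λ {x} {y} e →
      algebra (sign e) (walkSign G (conn b x)) (walkSign G (conn b y)) (walkSign G (conn y b))
        (trans (sym (walkSign-◅◅ (conn b x) (e ◅ conn y b)))
               (closed-walk-positive (conn b x ◅◅ e ◅ conn y b)))
        (trans (sym (walkSign-◅◅ (conn b y) (conn y b)))
               (closed-walk-positive (conn b y ◅◅ conn y b)))
      where
      algebra : ∀ e x y t → x * (e * t) ≡ + → y * t ≡ + → e ≡ x * y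
      algebra e x y t p q = trans (identity e x y t) (cong₂ (λ a b → a * b * (x * y)) p q)
        where
        identity : ∀ e x y t → e ≡ x * (e * t) * (y * t) * (x * y)
        identity = from-yes (∀-sign? λ e → ∀-sign? λ x → ∀-sign? λ y → ∀-sign? λ t →
                               e ≟ x * (e * t) * (y * t) * (x * y))

-- Balance under embeddings and switching

module _ (G H : SignedGraph) where
  private
    module G = SignedGraph G
    module H = SignedGraph H

  -- An injective homomorphism maps cycles to cycles, and on a closed walk every factor of the
  -- switching `ψ` occurs twice.
  balanced-pullback :
    (f : G.Vertex → H.Vertex) → (∀ {x y} → f x ≡ f y → x ≡ y) →
    (adj : ∀ {x y} → G.Adj x y → H.Adj (f x) (f y)) (ψ : G.Vertex → Sign) →
    (∀ {x y} (e : G.Adj x y) → G.sign e ≡ ψ x * H.sign (adj e) * ψ y) →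
    Balanced H → Balanced G
  balanced-pullback f inj adj ψ switch bal {x} w (long , uniq) = trans (walkSign-switch w)
    (trans (cong (λ s → ψ x * s * ψ x) (bal (gmap f adj w)
       ( subst (3 ≤_) (trans (sym (length-map f (visited G w)))
                             (cong length (sym (visited-gmap w)))) long
       , subst Unique (sym (visited-gmap w)) (Unique.map⁺ inj uniq))))
     (trans (cong (_* ψ x) (*-identityʳ (ψ x))) (s*s≡+ (ψ x))))
    where
    visited-gmap : ∀ {x y} (w : Walk G x y) → visited H (gmap f adj w) ≡ List.map f (visited G w)
    visited-gmap ε               = refl
    visited-gmap (_◅_ {i = x} _ w) = cong (f x ∷_) (visited-gmap w)
    walkSign-switch : ∀ {x y} (w : Walk G x y) →
                      walkSign G w ≡ ψ x * walkSign H (gmap f adj w) * ψ y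
    walkSign-switch {x} ε = sym (trans (cong (_* ψ x) (*-identityʳ (ψ x))) (s*s≡+ (ψ x)))
    walkSign-switch {x} {z} (_◅_ {j = y} e w) rewrite switch e | walkSign-switch w =
      cancel (ψ x) (H.sign (adj e)) (ψ y) (walkSign H (gmap f adj w)) (ψ z)
      where
      cancel : ∀ x a y b z → x * a * y * (y * b * z) ≡ x * (a * b) * z
      cancel = from-yes (∀-sign? λ x → ∀-sign? λ a → ∀-sign? λ y → ∀-sign? λ b → ∀-sign? λ z →
                           x * a * y * (y * b * z) ≟ x * (a * b) * z)

-- Faces and incidence signs

face-≡ : ∀ {K : Complex n} {j} {F G : Face K j} → set F ≡ set G → F ≡ G
face-≡ refl = refl

Enumerates : Subset n → List (Fin n) → Set
Enumerates P xs = Unique xs × (∀ {v} → v ∈ xs ⇔ v ∈ₛ P)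

Enumerates-↭ : ∀ {P : Subset n} {xs ys} → Enumerates P xs → Enumerates P ys → xs ↭ ys
Enumerates-↭ (u , p) (v , q) = ∼bag⇒↭ (unique∧set⇒bag u v (⇔-sym q ⇔-∘ p))

elements : Subset n → List (Fin n)
elements []            = []
elements (inside  ∷ P) = zero ∷ List.map suc (elements P)
elements (outside ∷ P) = List.map suc (elements P)

length-elements : ∀ (P : Subset n) → length (elements P) ≡ ∣ P ∣
length-elements []            = refl
length-elements (inside  ∷ P) = cong suc (trans (length-map suc (elements P)) (length-elements P))
length-elements (outside ∷ P) = trans (length-map suc (elements P)) (length-elements P)

Enumerates-elements : ∀ (P : Subset n) → Enumerates P (elements P)
Enumerates-elements P = unique P , mk⇔ (sound P) (complete P)
  where
  unique : ∀ {n} (P : Subset n) → Unique (elements P)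
  unique []            = []
  unique (inside  ∷ P) = All.tabulate (λ v∈ → λ { refl → zero∉ v∈ })
                        ∷ Unique.map⁺ Fin.suc-injective (unique P)
    where
    zero∉ : zero ∉ List.map suc (elements P)
    zero∉ p with () ← proj₂ (proj₂ (∈-map⁻ suc p))
  unique (outside ∷ P) = Unique.map⁺ Fin.suc-injective (unique P)
  sound : ∀ {n} (P : Subset n) {v} → v ∈ elements P → v ∈ₛ P
  sound (inside  ∷ P) (here refl) = here
  sound (inside  ∷ P) (there p) with _ , q , refl ← ∈-map⁻ suc p = there (sound P q)
  sound (outside ∷ P) p         with _ , q , refl ← ∈-map⁻ suc p = there (sound P q)
  complete : ∀ {n} (P : Subset n) {v} → v ∈ₛ P → v ∈ elements P
  complete (inside  ∷ P) here      = here refl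
  complete (inside  ∷ P) (there p) = there (∈-map⁺ suc (complete P p))
  complete (outside ∷ P) (there p) = ∈-map⁺ suc (complete P p)

Enumerates-length : ∀ {P : Subset n} {xs} → Enumerates P xs → length xs ≡ ∣ P ∣
Enumerates-length {P = P} e =
  trans (↭-length (Enumerates-↭ e (Enumerates-elements P))) (length-elements P)

-- Monotone embeddings of vertex sets

-- Phrased by membership, to cover both `F ⊗ ⁅ v ⁆` as an image of `F` and a product face as an
-- image of its projection.
IsImage : (Fin m → Fin n) → Subset m → Subset n → Set
IsImage ι P Q = ∀ {w} → w ∈ₛ Q ⇔ ∃ λ u → u ∈ₛ P × ι u ≡ w

module _ {ι : Fin m → Fin n} (ι-mono : ∀ {x y} → x Fin.< y → ι x Fin.< ι y) where

  mono⇒injective : ∀ {x y} → ι x ≡ ι y → x ≡ y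
  mono⇒injective {x} {y} eq with Fin.<-cmp x y
  ... | tri< p _ _ = contradiction eq (Fin.<⇒≢ (ι-mono p))
  ... | tri≈ _ e _ = e
  ... | tri> _ _ p = contradiction (sym eq) (Fin.<⇒≢ (ι-mono p))

  invSign-mono : ∀ x y → invSign (toℕ (ι x)) (toℕ (ι y)) ≡ invSign (toℕ x) (toℕ y)
  invSign-mono x y with Fin.<-cmp x y
  ... | tri< p _ ¬q   = trans (invSign-≮ (ℕ.<-asym (ι-mono p))) (sym (invSign-≮ ¬q))
  ... | tri≈ _ refl _ = trans (below-self (ι x)) (sym (below-self x))
  ... | tri> _ _ q    = trans (invSign-< (ι-mono q)) (sym (invSign-< q))

  Enumerates-image : ∀ {P Q xs} → IsImage ι P Q → Enumerates P xs → Enumerates Q (List.map ι xs)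
  Enumerates-image img (u , e) = Unique.map⁺ mono⇒injective u , mk⇔
    (λ p → let v , v∈ , eq = ∈-map⁻ ι p in from img (v , to e v∈ , sym eq))
    (λ q → let v , v∈ , eq = to img q in subst (_∈ _) eq (∈-map⁺ ι (from e v∈)))

  ∣image∣ : ∀ {P Q} → IsImage ι P Q → ∣ Q ∣ ≡ ∣ P ∣
  ∣image∣ {P} img =
    trans (sym (Enumerates-length (Enumerates-image img (Enumerates-elements P))))
          (trans (length-map ι (elements P)) (length-elements P))

  ∈-image⁻ : ∀ {P Q x} → IsImage ι P Q → ι x ∈ₛ Q → x ∈ₛ P
  ∈-image⁻ {P} img ιx∈ with u , u∈ , eq ← to img ιx∈ = subst (_∈ₛ P) (mono⇒injective eq) u∈

  -- `below` does not depend on the order of the enumeration, and a monotone `ι` preserves every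
  -- comparison with `u`.
  below-image : ∀ {P Q xs ys} → IsImage ι P Q → Enumerates P xs → Enumerates Q ys →
                ∀ u → below (ι u) ys ≡ below u xs
  below-image {xs = xs} img ex ey u =
    trans (∏-↭ _ (Enumerates-↭ ey (Enumerates-image img ex)))
    (trans (∏-map _ ι xs) (∏-cong xs λ {z} _ → invSign-mono u z))

-- Incidence signs relative to the natural order

VecUnique-toList : ∀ {A : Set} {xs : Vec A k} → VecUnique.Unique xs → Unique (toList xs)
VecUnique-toList []       = []
VecUnique-toList (x ∷ u)  = toList⁺ x ∷ VecUnique-toList u

-- If the search reaches the untested last entry, all earlier ones were in `F`, so the last entry is
-- `u`.
lookup-missing-∉ : ∀ (F : Subset n) (xs : Vec (Fin n) (suc k)) {u} → u ∈ toList xs → u ∉ₛ F →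
                   lookup xs (missing F xs) ∉ₛ F
lookup-missing-∉ F (x ∷ [])         (here refl) u∉ = u∉
lookup-missing-∉ F (x ∷ xs@(_ ∷ _)) u∈          u∉ with x ∈? F
... | no  x∉ = x∉
... | yes x∈ = lookup-missing-∉ F xs (Any.tail (λ { refl → u∉ x∈ }) u∈) u∉

module _ {K : Complex n} (o : Orientation K) where

  orderList : ∀ {j} → Face K j → List (Fin n)
  orderList F = toList (order o F)

  Enumerates-order : ∀ {j} (F : Face K j) → Enumerates (set F) (orderList F)
  Enumerates-order F = VecUnique-toList (order-unique o F) ,
    order-∈ o F ⇔-∘ mk⇔ ∈-toList⁻ ∈-toList⁺

  switch : ∀ {j} → Face K j → Sign
  switch F = σ (orderList F)

  -- `permSign-σ` splits the permutation sign into two sorting signs, and `σ-removeAt` combines one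
  -- of them with `(-1)^j`. The orientation then enters only through the two switches.
  incidenceSign-switch : ∀ {j} (F : Face K j) (F̄ : Face K (suc j)) → set F ⊆ set F̄ →
    ∀ {u} → u ∈ₛ set F̄ → u ∉ₛ set F →
    incidenceSign o F F̄ ≡ switch F * switch F̄ * below u (orderList F̄)
  incidenceSign-switch F F̄ F⊆F̄ {u} u∈ u∉ = begin
    ([-1]^ toℕ j) * permSign rs zs
      ≡⟨ cong (([-1]^ toℕ j) *_) (permSign-σ rs zs rs-unique rs↭zs) ⟩
    ([-1]^ toℕ j) * (σ (toList rs) * switch F)   ≡⟨ *-assoc ([-1]^ toℕ j) _ _ ⟨
    ([-1]^ toℕ j) * σ (toList rs) * switch F
      ≡⟨ cong (_* switch F) (σ-removeAt ys (proj₁ eF̄) j) ⟩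
    switch F̄ * below (lookup ys j) (toList ys) * switch F
      ≡⟨ cong (λ x → switch F̄ * below x (toList ys) * switch F) lookup≡u ⟩
    switch F̄ * below u (toList ys) * switch F    ≡⟨ rearrange (switch F̄) _ (switch F) ⟩
    switch F * switch F̄ * below u (toList ys)    ∎
    where
    open ≡-Reasoning
    ys = order o F̄
    zs = order o F
    j  = missing (set F) ys
    rs = removeAt ys j
    eF  = Enumerates-order F
    eF̄ = Enumerates-order F̄
    rearrange : ∀ a b c → a * b * c ≡ c * a * b
    rearrange = from-yes (∀-sign? λ a → ∀-sign? λ b → ∀-sign? λ c → a * b * c ≟ c * a * b)
    ys↭u∷zs : toList ys ↭ u ∷ toList zs
    ys↭u∷zs = unique-⊆⇒↭
      (All.tabulate (λ v∈ → λ { refl → u∉ (to (proj₂ eF) v∈) }) ∷ proj₁ eF)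
      (λ { (here refl) → from (proj₂ eF̄) u∈
         ; (there v∈)  → from (proj₂ eF̄) (F⊆F̄ (to (proj₂ eF) v∈)) })
      (trans (length-toList ys) (cong suc (sym (length-toList zs))))
    -- The entry found by `missing` lies outside `F`, and `u` is the only such entry of `ys`.
    lookup≡u : lookup ys j ≡ u
    lookup≡u with ∈-resp-↭ ys↭u∷zs (∈-toList⁺ (∈-lookup j ys))
    ... | here eq  = eq
    ... | there p  = contradiction (to (proj₂ eF) p)
                       (lookup-missing-∉ (set F) ys (from (proj₂ eF̄) u∈) u∉)
    rs↭zs : toList rs ↭ toList zs
    rs↭zs = drop-∷ (↭-trans (↭-sym (toList-removeAt ys j))
                            (subst (λ x → toList ys ↭ x ∷ toList zs) (sym lookup≡u) ys↭u∷zs))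
    rs-unique : Unique (toList rs)
    rs-unique = ↭ₛ.Unique-resp-↭ (setoid _) (↭⇒↭ₛ (↭-sym rs↭zs)) (proj₁ eF)

-- Transfer along monotone embeddings

module _ {K : Complex m} {L : Complex n} (oK : Orientation K) (oL : Orientation L)
         {ι : Fin m → Fin n} (ι-mono : ∀ {x y} → x Fin.< y → ι x Fin.< ι y) where

  -- After expansion by `incidenceSign-switch` the two incidence signs differ only in their
  -- switches, since `below-image` identifies the remaining factors.
  incidenceSign-image :
    ∀ {j} (F : Face K j) (F̄ : Face K (suc j)) (P : Face L j) (P̄ : Face L (suc j)) →
    IsImage ι (set F) (set P) → IsImage ι (set F̄) (set P̄) → set F ⊂ set F̄ → set P ⊆ set P̄ →
    incidenceSign oL P P̄ ≡
    (switch oL P * switch oK F) * incidenceSign oK F F̄ * (switch oL P̄ * switch oK F̄)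
  incidenceSign-image F F̄ P P̄ img imḡ (F⊆F̄ , u , u∈ , u∉) P⊆P̄
    rewrite incidenceSign-switch oK F F̄ F⊆F̄ u∈ u∉
          | incidenceSign-switch oL P P̄ P⊆P̄ (from imḡ (u , u∈ , refl)) (u∉ ∘ ∈-image⁻ ι-mono img)
          | below-image ι-mono imḡ (Enumerates-order oK F̄) (Enumerates-order oL P̄) u
    = cancel (switch oL P) (switch oL P̄) (below u (orderList oK F̄)) (switch oK F) (switch oK F̄)
    where
    cancel : ∀ p p̄ b f f̄ → p * p̄ * b ≡ (p * f) * (f * f̄ * b) * (p̄ * f̄)
    cancel = from-yes (∀-sign? λ p → ∀-sign? λ p̄ → ∀-sign? λ b → ∀-sign? λ f → ∀-sign? λ f̄ →
                         p * p̄ * b ≟ (p * f) * (f * f̄ * b) * (p̄ * f̄))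

  -- `push` embeds `B K oK i` into `B L oL i`, with signs agreeing up to the switching `ψ`, so
  -- `balanced-pullback` applies.
  balanced-preimage : (push : Subset m → Subset n) → (∀ P → IsImage ι P (push P)) →
    (∀ {P} → IsFace K P → IsFace L (push P)) →
    ∀ i → Balanced (B L oL i) → Balanced (B K oK i)
  balanced-preimage push img face⁺ i = balanced-pullback (B K oK i) (B L oL i) f f-injective adj ψ
    λ { (up {F} {F̄} p)   → sign-adj F F̄ p
      ; (down {F} {F̄} p) → trans (sign-adj F F̄ p) (reverse (ψ (inj₁ F)) _ (ψ (inj₂ F̄))) }
    where
    pushFace : ∀ {j} → Face K j → Face L j
    pushFace (face X f c) = face (push X) (face⁺ f) (trans (∣image∣ ι-mono (img X)) c)
    push-⊆⁻ : ∀ {P Q} → push P ⊆ push Q → P ⊆ Q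
    push-⊆⁻ {P} {Q} sub x∈ = ∈-image⁻ ι-mono (img Q) (sub (from (img P) (_ , x∈ , refl)))
    push-⊆⁺ : ∀ {P Q} → P ⊆ Q → push P ⊆ push Q
    push-⊆⁺ {P} {Q} sub w∈ = let u , u∈ , eq = to (img P) w∈ in from (img Q) (u , sub u∈ , eq)
    push-⊂ : ∀ {P Q} → P ⊂ Q → push P ⊂ push Q
    push-⊂ {P} {Q} (sub , u , u∈ , u∉) =
      push-⊆⁺ sub , ι u , from (img Q) (u , u∈ , refl) , u∉ ∘ ∈-image⁻ ι-mono (img P)
    pushFace-injective : ∀ {j} {F G : Face K j} → pushFace F ≡ pushFace G → F ≡ G
    pushFace-injective {F = F} {G} eq = face-≡ (⊆-antisym
      (push-⊆⁻ λ {x} → subst (x ∈ₛ_) (cong set eq))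
      (push-⊆⁻ λ {x} → subst (x ∈ₛ_) (sym (cong set eq))))
    f : SignedGraph.Vertex (B K oK i) → SignedGraph.Vertex (B L oL i)
    f (inj₁ F) = inj₁ (pushFace F)
    f (inj₂ F) = inj₂ (pushFace F)
    f-injective : ∀ {x y} → f x ≡ f y → x ≡ y
    f-injective {inj₁ _} {inj₁ _} eq = cong inj₁ (pushFace-injective (Sum.inj₁-injective eq))
    f-injective {inj₂ _} {inj₂ _} eq = cong inj₂ (pushFace-injective (Sum.inj₂-injective eq))
    adj : ∀ {x y} → Incident K oK i x y → Incident L oL i (f x) (f y)
    adj (up p)   = up (push-⊂ p)
    adj (down p) = down (push-⊂ p)
    ψ : SignedGraph.Vertex (B K oK i) → Sign
    ψ (inj₁ F) = switch oL (pushFace F) * switch oK F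
    ψ (inj₂ F) = switch oL (pushFace F) * switch oK F
    sign-adj : ∀ (F : Face K i) (F̄ : Face K (suc i)) → set F ⊂ set F̄ →
      incidenceSign oK F F̄ ≡
      ψ (inj₁ F) * incidenceSign oL (pushFace F) (pushFace F̄) * ψ (inj₂ F̄)
    sign-adj F F̄ p = trans (cancel (ψ (inj₁ F)) (incidenceSign oK F F̄) (ψ (inj₂ F̄)))
      (cong (λ s → ψ (inj₁ F) * s * ψ (inj₂ F̄))
        (sym (incidenceSign-image F F̄ (pushFace F) (pushFace F̄) (img _) (img _) p
          (proj₁ (push-⊂ p)))))
      where
      cancel : ∀ a b c → b ≡ a * (a * b * c) * c
      cancel = from-yes (∀-sign? λ a → ∀-sign? λ b → ∀-sign? λ c → b ≟ a * (a * b * c) * c)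
    reverse : ∀ a b c → a * b * c ≡ c * b * a
    reverse = from-yes (∀-sign? λ a → ∀-sign? λ b → ∀-sign? λ c → a * b * c ≟ c * b * a)

-- Potentials of B as functions of subsets

module _ {K : Complex m} (o : Orientation K) (i : ℕ) where

  _≟ᵛ_ : DecidableEquality (SignedGraph.Vertex (B K o i))
  _≟ᵛ_ = Sum.≡-dec _≟ᶠ_ _≟ᶠ_
    where
    _≟ᶠ_ : ∀ {j} → DecidableEquality (Face K j)
    F ≟ᶠ G = map′ face-≡ (cong set) (≡-dec Bool._≟_ (set F) (set G))

  -- Serves to find a base point for the potential. The irrelevant proofs inside a face are
  -- recovered from decidability.
  face? : ∀ j → Dec (Face K j)
  face? j = map′ (λ (X , f , c) → face X f c)
                 (λ { (face X f c) → X , recompute (isFace? K X) f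
                                     , recompute (∣ X ∣ ℕ.≟ suc j) c })
                 (anySubset? λ X → isFace? K X ×-dec ∣ X ∣ ℕ.≟ suc j)

  vertex? : Dec (SignedGraph.Vertex (B K o i))
  vertex? = face? i ⊎-dec face? (suc i)

  -- A potential with the switches factored out. It is defined on all subsets so that it can be
  -- evaluated at the projections of a product face, one of which is a single vertex.
  IsSetPotential : (Subset m → Sign) → Set
  IsSetPotential c = ∀ (F : Face K i) (F̄ : Face K (suc i)) → set F ⊂ set F̄ →
    incidenceSign o F F̄ ≡ switch o F * switch o F̄ * (c (set F) * c (set F̄))

  balanced⇒setPotential : Connected (B K o i) → Balanced (B K o i) → ∃ IsSetPotential
  balanced⇒setPotential conn bal = c , λ F F̄ p → trans (φ-pot (up {F = F} {F̄} p))
    (trans (cancel (φ (inj₁ F)) (φ (inj₂ F̄)) (switch o F) (switch o F̄))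
           (cong₂ (λ a b → switch o F * switch o F̄ * (a * b))
                  (sym (c-lower F)) (sym (c-upper F̄))))
    where
    potential = balanced⇒potential (B K o i) _≟ᵛ_ bal conn vertex?
    φ = proj₁ potential
    φ-pot : IsPotential (B K o i) φ
    φ-pot = proj₂ potential
    is? : ∀ j X → Dec (IsFace K X × ∣ X ∣ ≡ suc j)
    is? j X = isFace? K X ×-dec ∣ X ∣ ℕ.≟ suc j
    c : Subset m → Sign
    c X with is? i X | is? (suc i) X
    ... | yes (f , e) | _           = let F = face X f e in φ (inj₁ F) * switch o F
    ... | no _        | yes (f , e) = let F = face X f e in φ (inj₂ F) * switch o F
    ... | no _        | no _        = +
    c-lower : ∀ F → c (set F) ≡ φ (inj₁ F) * switch o F
    c-lower (face X f e) with is? i X | is? (suc i) X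
    ... | yes _ | _ = refl
    ... | no ¬p | _ = ⊥-elim-irr (¬p (f , e))
    c-upper : ∀ F → c (set F) ≡ φ (inj₂ F) * switch o F
    c-upper (face X f e) with is? i X | is? (suc i) X
    -- The two cardinalities `suc i` and `suc (suc i)` differ, so the first test of `c` cannot
    -- capture an upper face.
    ... | yes (_ , e′) | _    = ⊥-elim-irr (ℕ.1+n≢n (trans (sym e) e′))
    ... | no _        | yes _ = refl
    ... | no _        | no ¬p = ⊥-elim-irr (¬p (f , e))
    cancel : ∀ a b s t → a * b ≡ s * t * ((a * s) * (b * t))
    cancel = from-yes (∀-sign? λ a → ∀-sign? λ b → ∀-sign? λ s → ∀-sign? λ t →
                         a * b ≟ s * t * ((a * s) * (b * t)))

-- The two families of slices of a product

combine-monoʳ-< : ∀ (u : Fin m) {x y : Fin n} → x Fin.< y → combine u x Fin.< combine u y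
combine-monoʳ-< {n = n} u {x} {y} x<y =
  subst₂ ℕ._<_ (sym (toℕ-combine u x)) (sym (toℕ-combine u y)) (ℕ.+-monoʳ-< (n ℕ.* toℕ u) x<y)

tabulate-∈ : ∀ {Q : Fin n → Set} (Q? : ∀ v → Dec (Q v)) {v} →
             v ∈ₛ tabulate (λ v → does (Q? v)) ⇔ Q v
tabulate-∈ Q? {v} = mk⇔
  (λ v∈ → witness (Q? v) (trans (sym (lookup∘tabulate _ v)) ([]=⇒lookup v∈)))
  (λ q → lookup⇒[]= v _ (trans (lookup∘tabulate _ v) (dec-true (Q? v) q)))
  where
  witness : ∀ {A : Set} (a? : Dec A) → does a? ≡ true → A
  witness (yes a) _ = a

module Slices (m n : ℕ) where

  -- combine with its implicit arguments fixed, since m cannot be inferred from m * n.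
  pair : Fin m → Fin n → Fin (m ℕ.* n)
  pair = combine

  π₁ : Subset (m ℕ.* n) → Subset m
  π₁ P = tabulate λ u → does (any? λ v → pair u v ∈? P)

  π₂ : Subset (m ℕ.* n) → Subset n
  π₂ P = tabulate λ v → does (any? λ u → pair u v ∈? P)

  ∈-π₁ : ∀ P {u} → u ∈ₛ π₁ P ⇔ ∃ λ v → pair u v ∈ₛ P
  ∈-π₁ P = tabulate-∈ λ u → any? λ v → pair u v ∈? P

  ∈-π₂ : ∀ P {v} → v ∈ₛ π₂ P ⇔ ∃ λ u → pair u v ∈ₛ P
  ∈-π₂ P = tabulate-∈ λ v → any? λ u → pair u v ∈? P

  ∈-⊗⁅⁆⁻ : ∀ F v {u v′} → pair u v′ ∈ₛ F ⊗ ⁅ v ⁆ → u ∈ₛ F × v′ ≡ v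
  ∈-⊗⁅⁆⁻ F v p = let u∈ , v∈ = ∈-⊗⁻ {F = F} {⁅ v ⁆} p in u∈ , x∈⁅y⁆⇒x≡y v v∈

  ∈-⁅⁆⊗⁻ : ∀ u G {u′ v} → pair u′ v ∈ₛ ⁅ u ⁆ ⊗ G → u′ ≡ u × v ∈ₛ G
  ∈-⁅⁆⊗⁻ u G p = let u∈ , v∈ = ∈-⊗⁻ {F = ⁅ u ⁆} {G} p in x∈⁅y⁆⇒x≡y u u∈ , v∈

  ⊗⁅⁆-image : ∀ v F → IsImage (λ u → pair u v) F (F ⊗ ⁅ v ⁆)
  ⊗⁅⁆-image v F = mk⇔ image
    (λ { (u , u∈ , refl) → ∈-⊗⁺ {F = F} {⁅ v ⁆} u∈ (x∈⁅x⁆ v) })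
    where
    image : ∀ {w} → w ∈ₛ F ⊗ ⁅ v ⁆ → ∃ λ u → u ∈ₛ F × pair u v ≡ w
    image {w} w∈ with u , v′ , refl ← combine-surjective {m} {n} w
                 with u∈ , refl ← ∈-⊗⁅⁆⁻ F v w∈ = u , u∈ , refl

  ⁅⁆⊗-image : ∀ u G → IsImage (pair u) G (⁅ u ⁆ ⊗ G)
  ⁅⁆⊗-image u G = mk⇔ image
    (λ { (v , v∈ , refl) → ∈-⊗⁺ {F = ⁅ u ⁆} {G} (x∈⁅x⁆ u) v∈ })
    where
    image : ∀ {w} → w ∈ₛ ⁅ u ⁆ ⊗ G → ∃ λ v → v ∈ₛ G × pair u v ≡ w
    image {w} w∈ with u′ , v , refl ← combine-surjective {m} {n} w
                 with refl , v∈ ← ∈-⁅⁆⊗⁻ u G w∈ = v , v∈ , refl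

  -- An inclusion instead of an equation lets the slice of `P̄` serve for its subface `P` too.
  module Horizontal {P : Subset (m ℕ.* n)} {F : Subset m} {v : Fin n} (sub : P ⊆ F ⊗ ⁅ v ⁆) where

    π₁-⊆ : π₁ P ⊆ F
    π₁-⊆ u∈ = proj₁ (∈-⊗⁅⁆⁻ F v (sub (proj₂ (to (∈-π₁ P) u∈))))

    π₁-image : IsImage (λ u → pair u v) (π₁ P) P
    π₁-image = mk⇔ image preimage
      where
      image : ∀ {w} → w ∈ₛ P → ∃ λ u → u ∈ₛ π₁ P × pair u v ≡ w
      image {w} w∈ with u , v′ , refl ← combine-surjective {m} {n} w
                   with _ , refl ← ∈-⊗⁅⁆⁻ F v (sub w∈) = u , from (∈-π₁ P) (v , w∈) , refl
      preimage : ∀ {w} → (∃ λ u → u ∈ₛ π₁ P × pair u v ≡ w) → w ∈ₛ P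
      preimage (u , u∈ , refl) with v′ , w∈ ← to (∈-π₁ P) u∈
                               with _ , refl ← ∈-⊗⁅⁆⁻ F v (sub w∈) = w∈

    -- The witness `w` excludes the empty set, whose projection is empty.
    π₂-≡ : ∀ {w} → w ∈ₛ P → π₂ P ≡ ⁅ v ⁆
    π₂-≡ {w} w∈ with u , v₀ , refl ← combine-surjective {m} {n} w
                with _ , refl ← ∈-⊗⁅⁆⁻ F v (sub w∈) = ⊆-antisym π₂⊆ ⊆π₂
      where
      π₂⊆ : π₂ P ⊆ ⁅ v ⁆
      π₂⊆ v∈ with _ , w∈ ← to (∈-π₂ P) v∈ with _ , refl ← ∈-⊗⁅⁆⁻ F v (sub w∈) = x∈⁅x⁆ v
      ⊆π₂ : ⁅ v ⁆ ⊆ π₂ P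
      ⊆π₂ v∈ with refl ← x∈⁅y⁆⇒x≡y v v∈ = from (∈-π₂ P) (u , w∈)

  module Vertical {P : Subset (m ℕ.* n)} {G : Subset n} {u : Fin m} (sub : P ⊆ ⁅ u ⁆ ⊗ G) where

    π₂-⊆ : π₂ P ⊆ G
    π₂-⊆ v∈ = proj₂ (∈-⁅⁆⊗⁻ u G (sub (proj₂ (to (∈-π₂ P) v∈))))

    π₂-image : IsImage (pair u) (π₂ P) P
    π₂-image = mk⇔ image preimage
      where
      image : ∀ {w} → w ∈ₛ P → ∃ λ v → v ∈ₛ π₂ P × pair u v ≡ w
      image {w} w∈ with u′ , v , refl ← combine-surjective {m} {n} w
                   with refl , _ ← ∈-⁅⁆⊗⁻ u G (sub w∈) = v , from (∈-π₂ P) (u , w∈) , refl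
      preimage : ∀ {w} → (∃ λ v → v ∈ₛ π₂ P × pair u v ≡ w) → w ∈ₛ P
      preimage (v , v∈ , refl) with u′ , w∈ ← to (∈-π₂ P) v∈
                               with refl , _ ← ∈-⁅⁆⊗⁻ u G (sub w∈) = w∈

    π₁-≡ : ∀ {w} → w ∈ₛ P → π₁ P ≡ ⁅ u ⁆
    π₁-≡ {w} w∈ with u₀ , v , refl ← combine-surjective {m} {n} w
                with refl , _ ← ∈-⁅⁆⊗⁻ u G (sub w∈) = ⊆-antisym π₁⊆ ⊆π₁
      where
      π₁⊆ : π₁ P ⊆ ⁅ u ⁆
      π₁⊆ u∈ with _ , w∈ ← to (∈-π₁ P) u∈ with refl , _ ← ∈-⁅⁆⊗⁻ u G (sub w∈) = x∈⁅x⁆ u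
      ⊆π₁ : ⁅ u ⁆ ⊆ π₁ P
      ⊆π₁ u∈ with refl ← x∈⁅y⁆⇒x≡y u u∈ = from (∈-π₁ P) (v , w∈)

-- The potential of the product

module _ {K : Complex m} {L : Complex n} (oK : Orientation K) (oL : Orientation L)
         {ι : Fin m → Fin n} (ι-mono : ∀ {x y} → x Fin.< y → ι x Fin.< ι y) where

  -- As `ι` is injective, `X` and `X̄` have the cardinalities of `P` and `P̄`, so `pot` applies to
  -- them. In `incidenceSign-image` the switches of `K` then cancel.
  incidenceSign-slice : ∀ {i} c → IsSetPotential oK i c →
    ∀ {X X̄} (P : Face L i) (P̄ : Face L (suc i)) → IsFace K X̄ → set P ⊂ set P̄ →
    IsImage ι X (set P) → IsImage ι X̄ (set P̄) →
    incidenceSign oL P P̄ ≡ switch oL P * switch oL P̄ * (c X * c X̄)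
  incidenceSign-slice {i} c pot {X} {X̄} P@(face _ _ e) P̄@(face _ _ ē)
      f̄ (P⊆P̄ , w , w∈ , w∉) img imḡ
    = trans (incidenceSign-image oK oL ι-mono F F̄ P P̄ img imḡ F⊂F̄ P⊆P̄)
    (trans (cong (λ s → switch oL P * switch oK F * s * (switch oL P̄ * switch oK F̄))
                 (pot F F̄ F⊂F̄))
           (cancel (switch oL P) (switch oL P̄) (switch oK F) (switch oK F̄) (c X * c X̄)))
    where
    X⊆X̄ : X ⊆ X̄
    X⊆X̄ x∈ = ∈-image⁻ ι-mono imḡ (P⊆P̄ (from img (_ , x∈ , refl)))
    F : Face K i
    F = face X (down-closed K f̄ X⊆X̄) (trans (sym (∣image∣ ι-mono img)) e)
    F̄ : Face K (suc i)
    F̄ = face X̄ f̄ (trans (sym (∣image∣ ι-mono imḡ)) ē)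
    F⊂F̄ : X ⊂ X̄
    -- The preimage of a vertex of `P̄` outside `P` lies in `X̄` but not in `X`.
    F⊂F̄ with u , u∈ , refl ← to imḡ w∈ = X⊆X̄ , u , u∈ , λ u∈X → w∉ (from img (u , u∈X , refl))
    cancel : ∀ p p̄ f f̄ c → (p * f) * (f * f̄ * c) * (p̄ * f̄) ≡ p * p̄ * c
    cancel = from-yes (∀-sign? λ p → ∀-sign? λ p̄ → ∀-sign? λ f → ∀-sign? λ f̄ → ∀-sign? λ c →
                         (p * f) * (f * f̄ * c) * (p̄ * f̄) ≟ p * p̄ * c)

module _ {K₁ : Complex m} {K₂ : Complex n}
         (o₁ : Orientation K₁) (o₂ : Orientation K₂) (o : Orientation (K₁ □ K₂)) (i : ℕ) where

  open Slices m n

  □-setPotential : ∀ c₁ c₂ → IsSetPotential o₁ i c₁ → IsSetPotential o₂ i c₂ →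
                   IsSetPotential o i (λ P → c₁ (π₁ P) * c₂ (π₂ P))
  □-setPotential c₁ c₂ pot₁ pot₂ P P̄@(face Q̄ f̄ _) P⊂P̄@(P⊆P̄ , w̄ , w̄∈ , _) =
    -- `by-slice` allows any `Q` above `Q̄`, so that the product face can be matched with a free
    -- index; here `Q` is `Q̄` itself.
    by-slice (recompute (isFace? (K₁ □ K₂) Q̄) f̄) ⊆-refl
    where
    w∈ : lookup (order o P) zero ∈ₛ set P
    w∈ = to (order-∈ o P) (∈-lookup zero (order o P))
    absorbʳ : ∀ a b c → a * b ≡ (a * c) * (b * c)
    absorbʳ = from-yes (∀-sign? λ a → ∀-sign? λ b → ∀-sign? λ c → a * b ≟ (a * c) * (b * c))
    absorbˡ : ∀ a b c → a * b ≡ (c * a) * (c * b)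
    absorbˡ = from-yes (∀-sign? λ a → ∀-sign? λ b → ∀-sign? λ c → a * b ≟ (c * a) * (c * b))
    by-slice : ∀ {Q} → ProductFace K₁ K₂ Q → Q̄ ⊆ Q → incidenceSign o P P̄ ≡
      switch o P * switch o P̄ * ((c₁ (π₁ (set P)) * c₂ (π₂ (set P))) * (c₁ (π₁ Q̄) * c₂ (π₂ Q̄)))
    by-slice (horizontal {F} f v) P̄⊆
      -- Both faces project to the same vertex `v`, so `c₂ ⁅ v ⁆` occurs twice and `absorbʳ` removes
      -- it.
      rewrite Horizontal.π₂-≡ {F = F} {v} (P̄⊆ ∘ P⊆P̄) w∈ | Horizontal.π₂-≡ {F = F} {v} P̄⊆ w̄∈ =
      trans (incidenceSign-slice o₁ o (combine-monoˡ-< v v) c₁ pot₁ P P̄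
               (down-closed K₁ f S̄.π₁-⊆) P⊂P̄ S.π₁-image S̄.π₁-image)
            (cong (switch o P * switch o P̄ *_) (absorbʳ (c₁ (π₁ (set P))) (c₁ (π₁ Q̄)) (c₂ ⁅ v ⁆)))
      where
      module S  = Horizontal {set P} {F} {v} (P̄⊆ ∘ P⊆P̄)
      module S̄ = Horizontal {Q̄} {F} {v} P̄⊆
    by-slice (vertical u {G} g) P̄⊆
      rewrite Vertical.π₁-≡ {G = G} {u} (P̄⊆ ∘ P⊆P̄) w∈ | Vertical.π₁-≡ {G = G} {u} P̄⊆ w̄∈ =
      trans (incidenceSign-slice o₂ o (combine-monoʳ-< u) c₂ pot₂ P P̄
               (down-closed K₂ g S̄.π₂-⊆) P⊂P̄ S.π₂-image S̄.π₂-image)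
            (cong (switch o P * switch o P̄ *_) (absorbˡ (c₂ (π₂ (set P))) (c₂ (π₂ Q̄)) (c₁ ⁅ u ⁆)))
      where
      module S  = Vertical {set P} {G} {u} (P̄⊆ ∘ P⊆P̄)
      module S̄ = Vertical {Q̄} {G} {u} P̄⊆

-- Multiplying `c` by the switches gives back a potential on the vertices of `B K o i`.
setPotential⇒balanced : ∀ {K : Complex m} (o : Orientation K) i c →
                        IsSetPotential o i c → Balanced (B K o i)
setPotential⇒balanced {K = K} o i c pot = potential⇒balanced (B K o i) {φ}
  λ { (up {F} {F̄} p)   → φ-pot F F̄ p
    ; (down {F} {F̄} p) → trans (φ-pot F F̄ p) (*-comm (φ (inj₁ F)) (φ (inj₂ F̄))) }
  where
  φ : SignedGraph.Vertex (B K o i) → Sign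
  φ (inj₁ F) = switch o F * c (set F)
  φ (inj₂ F) = switch o F * c (set F)
  φ-pot : ∀ F F̄ → set F ⊂ set F̄ → incidenceSign o F F̄ ≡ φ (inj₁ F) * φ (inj₂ F̄)
  φ-pot F F̄ p = trans (pot F F̄ p)
    (interchange (switch o F) (switch o F̄) (c (set F)) (c (set F̄)))

mainTheorem13 : ∀ {m n} (i : ℕ) (K₁ : Complex m) (K₂ : Complex n)
    (o₁ : Orientation K₁) (o₂ : Orientation K₂) (o : Orientation (K₁ □ K₂)) →
    Connected (B K₁ o₁ i) → Connected (B K₂ o₂ i) →
    Balanced (B (K₁ □ K₂) o i) ⇔ (Balanced (B K₁ o₁ i) × Balanced (B K₂ o₂ i))
mainTheorem13 {m} {n} i K₁ K₂ o₁ o₂ o conn₁ conn₂ = mk⇔ factors product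
  where
  open Slices m n using (π₁; π₂; ⊗⁅⁆-image; ⁅⁆⊗-image)
  point : ∀ {k} → NonZero k → Fin k
  point {suc _} _ = zero
  factors : Balanced (B (K₁ □ K₂) o i) → Balanced (B K₁ o₁ i) × Balanced (B K₂ o₂ i)
  factors bal =
    -- A single slice in each direction contains a copy of the factor; nonemptiness of the other
    -- factor supplies the vertex to slice at.
    let u = point (nonEmpty K₁)
        v = point (nonEmpty K₂)
    in balanced-preimage o₁ o (combine-monoˡ-< v v) (_⊗ ⁅ v ⁆) (⊗⁅⁆-image v)
         (λ f → horizontal f v) i bal
     , balanced-preimage o₂ o (combine-monoʳ-< u) (⁅ u ⁆ ⊗_) (⁅⁆⊗-image u) (vertical u) i bal
  product : Balanced (B K₁ o₁ i) × Balanced (B K₂ o₂ i) → Balanced (B (K₁ □ K₂) o i)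
  product (bal₁ , bal₂) =
    let c₁ , pot₁ = balanced⇒setPotential o₁ i conn₁ bal₁
        c₂ , pot₂ = balanced⇒setPotential o₂ i conn₂ bal₂
    in setPotential⇒balanced o i (λ P → c₁ (π₁ P) * c₂ (π₂ P))
         (□-setPotential o₁ o₂ o i c₁ c₂ pot₁ pot₂)
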